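{- Let $C\subseteq\omega$ be a co-maximal set, and let $\Psi$ be the $\Pi^0_3$ sentence, in the language of linear orders, stating that every element has an immediate successor, i.e. $$\Psi:\quad \forall x\,\exists y\,\forall z\,\bigl[x<y\wedge\neg(x<z\wedge z<y)\bigr].$$ Then there is a computable linear order $\mathcal{L}$ of order type $\omega$ such that $\mathcal{L}\models\Psi$ but $\Pi_C\mathcal{L}\models\neg\Psi$.
   Context: $\omega$ denotes the set of natural numbers. $X\subseteq^* Y$ means that $X\setminus Y$ is finite. An infinite set $C\subseteq\omega$ is cohesive if for every c.e. set $W$, either $W\cap C$ or $\overline{W}\cap C$ is finite. A set $M\subseteq\omega$ is maximal if $M$ is c.e. and $\overline{M}$ is cohesive. A set is co-maximal if it is the complement of a maximal set (so co-maximal sets are cohesive). Linear orders are strict. A computable linear order $\mathcal{L}=(L,<_{\mathcal{L}})$ is one whose domain $L$ is a computable subset of $\omega$ and whose relation $<_{\mathcal{L}}$ is computable. It has order type $\omega$ if it is isomorphic to $\mathbb{N}$ with its usual order. Cohesive power: for a cohesive set $C$ and a computable linear order $\mathcal{L}=(L,<_{\mathcal{L}})$, let $D$ be the set of partial computable functions $\varphi:\omega\to L$ with $C\subseteq^*\mathrm{dom}(\varphi)$. For $\varphi,\psi\in D$ put $\varphi=_C\psi$ iff $C\subseteq^*\{x:\varphi(x){\downarrow}=\psi(x){\downarrow}\}$. The cohesive power $\Pi_C\mathcal{L}$ has domain $D/{=_C}$, with $[\varphi]<[\psi]$ iff $C\subseteq^*\{x:\varphi(x){\downarrow}<_{\mathcal{L}}\psi(x){\downarrow}\}$.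 -}

module Defs where

open import Data.Fin using (Fin; #_)
open import Data.List using (List)
import Data.List.Membership.Propositional as List
open import Data.Nat using (ℕ; zero; suc) renaming (_<_ to _<ℕ_)
open import Data.Product using (Σ; ∃; ∃-syntax; _×_; proj₁)
open import Data.Sum using (_⊎_)
open import Data.Vec using (Vec; []; _∷_; lookup)
open import Function using (_on_)
open import Level using (0ℓ)
open import Relation.Binary using (Rel; IsStrictTotalOrder)
open import Relation.Binary.Bundles.Raw using (RawRelation)
open import Relation.Binary.Morphism.Structures using (IsOrderIsomorphism)
open import Relation.Binary.PropositionalEquality using (_≡_)
open import Relation.Nullary using (¬_)
open import Relation.Unary using (Pred; _∈_; _⊆_; _≐_; _∩_; _∖_; ∁)

-- Partial recursive functions: Kleene's schemes, as programs ("indices") with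
-- an evaluation relation.

data PRec : ℕ → Set where
  zer  : PRec 0
  succ : PRec 1
  proj : ∀ {n} → Fin n → PRec n
  comp : ∀ {m n} → PRec m → Vec (PRec n) m → PRec n
  prim : ∀ {n} → PRec n → PRec (suc (suc n)) → PRec (suc n)
  mu   : ∀ {n} → PRec (suc n) → PRec n

infix 4 _[_]⇓_ _[_]⇓*_

mutual
  -- p [ xs ]⇓ y : the function computed by p converges at xs with value y.
  data _[_]⇓_ : ∀ {n} → PRec n → Vec ℕ n → ℕ → Set where
    ⇓zer   : zer [ [] ]⇓ 0
    ⇓succ  : ∀ {x} → succ [ x ∷ [] ]⇓ suc x
    ⇓proj  : ∀ {n} {i : Fin n} {xs} → proj i [ xs ]⇓ lookup xs i
    ⇓comp  : ∀ {m n} {f : PRec m} {gs : Vec (PRec n) m} {xs ys z} →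
             gs [ xs ]⇓* ys → f [ ys ]⇓ z → comp f gs [ xs ]⇓ z
    ⇓prim0 : ∀ {n} {f : PRec n} {g xs y} →
             f [ xs ]⇓ y → prim f g [ 0 ∷ xs ]⇓ y
    ⇓prim+ : ∀ {n} {f : PRec n} {g k xs y z} →
             prim f g [ k ∷ xs ]⇓ y → g [ k ∷ y ∷ xs ]⇓ z →
             prim f g [ suc k ∷ xs ]⇓ z
    ⇓mu    : ∀ {n} {f : PRec (suc n)} {xs y} →
             f [ y ∷ xs ]⇓ 0 →
             (∀ {z} → z <ℕ y → ∃[ k ] f [ z ∷ xs ]⇓ suc k) →
             mu f [ xs ]⇓ y

  data _[_]⇓*_ {n : ℕ} : ∀ {m} → Vec (PRec n) m → Vec ℕ n → Vec ℕ m → Set where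
    []  : ∀ {xs} → [] [ xs ]⇓* []
    _∷_ : ∀ {m} {g : PRec n} {gs : Vec (PRec n) m} {xs y ys} →
          g [ xs ]⇓ y → gs [ xs ]⇓* ys → (g ∷ gs) [ xs ]⇓* (y ∷ ys)

dom : PRec 1 → Pred ℕ 0ℓ
dom p x = ∃[ y ] p [ x ∷ [] ]⇓ y

CE : Pred ℕ 0ℓ → Set
CE W = ∃[ p ] W ≐ dom p

-- The characteristic function of P takes the value 1 (true) or 0 (false).
Decides : ∀ {n} → PRec n → Vec ℕ n → Set → Set
Decides p xs P = (P × p [ xs ]⇓ 1) ⊎ (¬ P × p [ xs ]⇓ 0)

ComputableSet : Pred ℕ 0ℓ → Set
ComputableSet X = ∃[ p ] ∀ x → Decides p (x ∷ []) (X x)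

ComputableRel : Rel ℕ 0ℓ → Set
ComputableRel R = ∃[ p ] ∀ x y → Decides p (x ∷ y ∷ []) (R x y)

Finite : Pred ℕ 0ℓ → Set
Finite X = Σ (List ℕ) λ xs → X ≐ (List._∈ xs)

Infinite : Pred ℕ 0ℓ → Set
Infinite X = ¬ Finite X

infix 4 _⊆*_

_⊆*_ : Pred ℕ 0ℓ → Pred ℕ 0ℓ → Set
X ⊆* Y = Finite (X ∖ Y)

Cohesive : Pred ℕ 0ℓ → Set₁
Cohesive C = Infinite C × (∀ W → CE W → Finite (W ∩ C) ⊎ Finite (∁ W ∩ C))

Maximal : Pred ℕ 0ℓ → Set₁
Maximal M = CE M × Cohesive (∁ M)

CoMaximal : Pred ℕ 0ℓ → Set₁
CoMaximal C = ∃[ M ] Maximal M × C ≐ ∁ M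

-- Structures for the language {<}.  The field _≈_ interprets the equality
-- symbol and _∼_ interprets <; a quotient D/≈ is represented by D with _≈_.
Structure : Set₁
Structure = RawRelation 0ℓ 0ℓ 0ℓ

-- First-order formulas with de Bruijn variables; # 0 is bound by the innermost
-- quantifier.
infix  6 _≺_ _≗_
infixr 5 _∧_
infixr 4 _∨_
infixr 3 _⇒_

data Formula (n : ℕ) : Set where
  _≺_ _≗_     : Fin n → Fin n → Formula n
  ~_          : Formula n → Formula n
  _∧_ _∨_ _⇒_ : Formula n → Formula n → Formula n
  all ex      : Formula (suc n) → Formula n

Sentence : Set
Sentence = Formula 0

module _ (𝓐 : Structure) where
  open RawRelation 𝓐

  Sat : ∀ {n} → Vec Carrier n → Formula n → Set
  Sat ρ (i ≺ j) = lookup ρ i ∼ lookup ρ j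
  Sat ρ (i ≗ j) = lookup ρ i ≈ lookup ρ j
  Sat ρ (~ φ)   = ¬ Sat ρ φ
  Sat ρ (φ ∧ ψ) = Sat ρ φ × Sat ρ ψ
  Sat ρ (φ ∨ ψ) = Sat ρ φ ⊎ Sat ρ ψ
  Sat ρ (φ ⇒ ψ) = Sat ρ φ → Sat ρ ψ
  Sat ρ (all φ) = ∀ a → Sat (a ∷ ρ) φ
  Sat ρ (ex φ)  = ∃[ a ] Sat (a ∷ ρ) φ

infix 4 _⊨_

_⊨_ : Structure → Sentence → Set
𝓐 ⊨ φ = Sat 𝓐 [] φ

-- ∀x ∃y ∀z [ x < y ∧ ¬ (x < z ∧ z < y) ]
Ψ : Sentence
Ψ = all (ex (all (x ≺ y ∧ ~ (x ≺ z ∧ z ≺ y))))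
  where
  x y z : Fin 3
  x = # 2
  y = # 1
  z = # 0

data QuantifierFree {n : ℕ} : Formula n → Set where
  lt  : ∀ {i j} → QuantifierFree (i ≺ j)
  eq  : ∀ {i j} → QuantifierFree (i ≗ j)
  neg : ∀ {φ} → QuantifierFree φ → QuantifierFree (~ φ)
  and : ∀ {φ ψ} → QuantifierFree φ → QuantifierFree ψ → QuantifierFree (φ ∧ ψ)
  or  : ∀ {φ ψ} → QuantifierFree φ → QuantifierFree ψ → QuantifierFree (φ ∨ ψ)
  imp : ∀ {φ ψ} → QuantifierFree φ → QuantifierFree ψ → QuantifierFree (φ ⇒ ψ)

mutual
  data IsΠ : ℕ → ∀ {n} → Formula n → Set where
    qf     : ∀ {n} {φ : Formula n} → QuantifierFree φ → IsΠ 0 φ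
    fromΣ  : ∀ {k n} {φ : Formula n} → IsΣ k φ → IsΠ (suc k) φ
    forAll : ∀ {k n} {φ : Formula (suc n)} → IsΠ (suc k) φ → IsΠ (suc k) (all φ)

  data IsΣ : ℕ → ∀ {n} → Formula n → Set where
    qf     : ∀ {n} {φ : Formula n} → QuantifierFree φ → IsΣ 0 φ
    fromΠ  : ∀ {k n} {φ : Formula n} → IsΠ k φ → IsΣ (suc k) φ
    exists : ∀ {k n} {φ : Formula (suc n)} → IsΣ (suc k) φ → IsΣ (suc k) (ex φ)

Ψ-isΠ₃ : IsΠ 3 Ψ
Ψ-isΠ₃ = forAll (fromΣ (exists (fromΠ (forAll (fromΣ (qf
           (and lt (neg (and lt lt)))))))))

record ComputableLinearOrder : Set₁ where
  infix 4 _<_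
  field
    L            : Pred ℕ 0ℓ
    _<_          : Rel ℕ 0ℓ
    <⊆L×L        : ∀ {x y} → x < y → x ∈ L × y ∈ L
    L-computable : ComputableSet L
    <-computable : ComputableRel _<_

  -- Elements of L are compared by their underlying numbers only; the proof of
  -- membership is irrelevant.
  structure : Structure
  structure = record
    { Carrier = ∃ L
    ; _≈_     = _≡_ on proj₁
    ; _∼_     = _<_ on proj₁
    }

  open RawRelation structure using (_≈_; _∼_)

  field
    isStrictTotalOrder : IsStrictTotalOrder _≈_ _∼_

open ComputableLinearOrder using (structure)

OrderTypeω : ComputableLinearOrder → Set
OrderTypeω 𝓛 = ∃[ f ] IsOrderIsomorphism _≈_ _≡_ _∼_ _<ℕ_ f
  where open RawRelation (structure 𝓛)

module _ (C : Pred ℕ 0ℓ) (𝓛 : ComputableLinearOrder) where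
  open ComputableLinearOrder 𝓛 hiding (structure)

  -- A partial computable φ : ω → L with C ⊆* dom φ, given by a program.  Two
  -- programs for the same function are identified by the equality =C below.
  record D : Set where
    field
      φ       : PRec 1
      φ-range : ∀ {x y} → φ [ x ∷ [] ]⇓ y → y ∈ L
      φ-dom   : C ⊆* dom φ

  open D

  _=C_ : Rel D 0ℓ
  f =C g = C ⊆* λ x → ∃[ a ] φ f [ x ∷ [] ]⇓ a × φ g [ x ∷ [] ]⇓ a

  _<C_ : Rel D 0ℓ
  f <C g = C ⊆* λ x →
    ∃[ a ] ∃[ b ] φ f [ x ∷ [] ]⇓ a × φ g [ x ∷ [] ]⇓ b × a < b

  CohesivePower : Structure
  CohesivePower = record { Carrier = D ; _≈_ = _=C_ ; _∼_ = _<C_ }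

{-# OPTIONS --safe #-}

-- Let M be the domain of q, with complement C.  The point (k , n), with
-- n ≤ k, is coded by k² + n, and is put into L if k = n or if the parity of the
-- number of m < n still outside M at stage k differs from that at stage k − 1.
-- Columns are ordered by n, and each column by decreasing k.  The approximations
-- converge, so columns are finite and the order has type ω.  In the power, let
-- ψ(n) = (n , n) be the last point of column n.  If φ were an immediate successor
-- of ψ, cohesiveness would allow nothing between ψ(n) and φ(n) for almost all
-- n ∈ C: otherwise a point found by search would give an element in between.  So
-- φ(n) is the first point of column n + 1, and its row is a stage from which the
-- parity of the size of C ∩ [0 , n] is correct.  This parity is thus a computable
-- function of φ(n); it alternates along C, and so splits C into two infinite
-- pieces, against cohesiveness.
module Submission where

open import Defs
open import Axiom.ExcludedMiddle using (ExcludedMiddle)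
open import Data.Fin using (Fin; zero; suc; #_; toℕ; fromℕ<)
open import Data.Fin.Properties using (pigeonhole; toℕ<n; toℕ-fromℕ<)
open import Data.List using (List; []; _∷_; filter; upTo)
import Data.List.Membership.Propositional as List
open import Data.List.Membership.Propositional.Properties using (∈-filter⁺; ∈-filter⁻; ∈-upTo⁺)
open import Data.List.Relation.Unary.Any using (here; there)
open import Data.Nat hiding (compare; parity)
open import Data.Nat.Induction using (<-wellFounded; Acc; acc)
open import Data.Nat.Properties
open import Data.Product using (Σ-syntax; ∃; ∃-syntax; _×_; _,_; proj₁; proj₂)
open import Data.Sum using (_⊎_; inj₁; inj₂; [_,_]′)
open import Data.Unit using (⊤; tt)
open import Data.Vec using (Vec; []; _∷_; head; tail; lookup; tabulate)
open import Data.Vec.Properties using (tabulate∘lookup)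
open import Function using (_∘_; id; case_of_)
open import Level using (0ℓ)
open import Relation.Binary using (IsStrictTotalOrder)
open import Relation.Binary.Definitions using (Tri; tri<; tri≈; tri>)
open import Relation.Binary.PropositionalEquality
open import Relation.Nullary using (¬_; Dec; yes; no; contradiction; _⊎-dec_)
open import Relation.Nullary.Decidable using (decidable-stable)
open import Relation.Unary using (Pred; ∁; _≐_; _∩_)
open ComputableLinearOrder using (structure)

-- Computable functions and decidable relations

Computable : ∀ {n} → (Vec ℕ n → ℕ) → Set
Computable f = ∃[ p ] ∀ xs → p [ xs ]⇓ f xs

Computable* : ∀ {m n} → (Vec ℕ n → Vec ℕ m) → Set
Computable* F = ∃[ ps ] ∀ xs → ps [ xs ]⇓* F xs

[]ᶜ : ∀ {n} → Computable* {n = n} (λ _ → [])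
[]ᶜ = [] , λ _ → []

infixr 5 _∷ᶜ_
_∷ᶜ_ : ∀ {m n} {f : Vec ℕ n → ℕ} {F : Vec ℕ n → Vec ℕ m} →
       Computable f → Computable* F → Computable* (λ xs → f xs ∷ F xs)
(p , p⇓) ∷ᶜ (ps , ps⇓) = p ∷ ps , λ xs → p⇓ xs ∷ ps⇓ xs

infixr 4 _∘ᶜ_
_∘ᶜ_ : ∀ {m n} {f : Vec ℕ m → ℕ} {F : Vec ℕ n → Vec ℕ m} →
       Computable f → Computable* F → Computable (f ∘ F)
(p , p⇓) ∘ᶜ (ps , ps⇓) = comp p ps , λ xs → ⇓comp (ps⇓ xs) (p⇓ _)

var : ∀ {n} (i : Fin n) → Computable (λ xs → lookup xs i)
var i = proj i , λ _ → ⇓proj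

-- Rearranging arguments is done by a vector of projections. The equation is asked for because the
-- tabulated lookups agree with vectors such as `tail xs` only up to `≡`.
vars : ∀ {m n} {F : Vec ℕ n → Vec ℕ m} (ρ : Fin m → Fin n) →
       (∀ xs → tabulate (lookup xs ∘ ρ) ≡ F xs) → Computable* F
vars {F = F} ρ e≡ =
  tabulate (proj ∘ ρ) , λ xs → subst (_ [ xs ]⇓*_) (e≡ xs) (reads ρ)
  where
  reads : ∀ {m n xs} (ρ : Fin m → Fin n) →
          tabulate (proj ∘ ρ) [ xs ]⇓* tabulate (lookup xs ∘ ρ)
  reads {zero}  ρ = []
  reads {suc m} ρ = ⇓proj ∷ reads (ρ ∘ suc)

drop₁ : ∀ {n} → Computable* {n} {1 + n} tail
drop₁ = vars suc λ { (_ ∷ xs) → tabulate∘lookup xs }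

drop₂ : ∀ {n} → Computable* {n} {2 + n} (tail ∘ tail)
drop₂ = vars (λ i → suc (suc i)) λ { (_ ∷ _ ∷ xs) → tabulate∘lookup xs }

drop₃ : ∀ {n} → Computable* {n} {3 + n} (tail ∘ tail ∘ tail)
drop₃ = vars (λ i → suc (suc (suc i))) λ { (_ ∷ _ ∷ _ ∷ xs) → tabulate∘lookup xs }

map₁ᶜ : ∀ (f : ℕ → ℕ) → Computable {1} (f ∘ head) →
        ∀ {n} {g : Vec ℕ n → ℕ} → Computable g → Computable (f ∘ g)
map₁ᶜ _ f g = f ∘ᶜ g ∷ᶜ []ᶜ

sucᶜ : ∀ {n} {f : Vec ℕ n → ℕ} → Computable f → Computable (suc ∘ f)
sucᶜ = map₁ᶜ suc (succ , λ { (_ ∷ []) → ⇓succ })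

const : ∀ {n} k → Computable {n} (λ _ → k)
const zero    = comp zer [] , λ _ → ⇓comp [] ⇓zer
const (suc k) = sucᶜ (const k)

-- The recursion equations are required only up to `≡`, so that functions defined by pattern
-- matching, such as `root` or `search`, fall under the scheme `prim`.
recᶜ : ∀ {n} {f : Vec ℕ n → ℕ} {g : Vec ℕ (2 + n) → ℕ} {h : Vec ℕ (suc n) → ℕ} →
       Computable f → Computable g →
       (∀ xs → h (0 ∷ xs) ≡ f xs) →
       (∀ k xs → h (suc k ∷ xs) ≡ g (k ∷ h (k ∷ xs) ∷ xs)) → Computable h
recᶜ {n} {h = h} (p , p⇓) (q , q⇓) base step = prim p q , λ { (k ∷ xs) → go k xs }
  where
  go : ∀ k (xs : Vec ℕ n) → prim p q [ k ∷ xs ]⇓ h (k ∷ xs)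
  go zero    xs = ⇓prim0 (subst (p [ xs ]⇓_) (sym (base xs)) (p⇓ xs))
  go (suc k) xs =
    ⇓prim+ (go k xs) (subst (q [ _ ]⇓_) (sym (step k xs)) (q⇓ _))

map₂ᶜ : ∀ (f : ℕ → ℕ → ℕ) → Computable {2} (λ xs → f (head xs) (head (tail xs))) →
        ∀ {n} {g h : Vec ℕ n → ℕ} → Computable g → Computable h →
        Computable (λ xs → f (g xs) (h xs))
map₂ᶜ _ f g h = f ∘ᶜ g ∷ᶜ h ∷ᶜ []ᶜ

predᶜ : ∀ {n} {f : Vec ℕ n → ℕ} → Computable f → Computable (pred ∘ f)
predᶜ = map₁ᶜ pred (recᶜ (const 0) (var (# 0)) (λ _ → refl) (λ _ _ → refl))

infixl 6 _+ᶜ_ _∸ᶜ_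
infixl 7 _*ᶜ_

_+ᶜ_ : ∀ {n} {f g : Vec ℕ n → ℕ} → Computable f → Computable g →
       Computable (λ xs → f xs + g xs)
_+ᶜ_ = map₂ᶜ _+_ (recᶜ (var (# 0)) (sucᶜ (var (# 1)))
                       (λ { (_ ∷ []) → refl }) (λ { _ (_ ∷ []) → refl }))

_*ᶜ_ : ∀ {n} {f g : Vec ℕ n → ℕ} → Computable f → Computable g →
       Computable (λ xs → f xs * g xs)
_*ᶜ_ = map₂ᶜ _*_ (recᶜ (const 0) (var (# 2) +ᶜ var (# 1))
                       (λ _ → refl) (λ { _ (_ ∷ []) → refl }))

_∸ᶜ_ : ∀ {n} {f g : Vec ℕ n → ℕ} → Computable f → Computable g →
       Computable (λ xs → f xs ∸ g xs)
-- The recursion runs on the subtrahend, which therefore has to come first.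
f ∸ᶜ g = map₂ᶜ (λ n m → m ∸ n)
  (recᶜ (var (# 0)) (predᶜ (var (# 1)))
        (λ { (_ ∷ []) → refl }) (λ { k (m ∷ []) → sym (pred[m∸n]≡m∸[1+n] m k) }))
  g f

ifz : ℕ → ℕ → ℕ → ℕ
ifz zero    a b = a
ifz (suc _) a b = b

ifzᶜ : ∀ {n} {f g h : Vec ℕ n → ℕ} → Computable f → Computable g → Computable h →
       Computable (λ xs → ifz (f xs) (g xs) (h xs))
ifzᶜ f g h =
  recᶜ {h = λ { (c ∷ a ∷ b ∷ []) → ifz c a b }} (var (# 0)) (var (# 3))
       (λ { (_ ∷ _ ∷ []) → refl }) (λ { _ (_ ∷ _ ∷ []) → refl })
  ∘ᶜ f ∷ᶜ g ∷ᶜ h ∷ᶜ []ᶜ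

DecidableBy : ∀ {n} → (Vec ℕ n → Set) → Set
DecidableBy P = ∃[ p ] ∀ xs → Decides p xs (P xs)

mapᵈ : ∀ {n} {P Q : Vec ℕ n → Set} → (∀ {xs} → P xs → Q xs) → (∀ {xs} → Q xs → P xs) →
       DecidableBy P → DecidableBy Q
mapᵈ P⇒Q Q⇒P (p , dec) = p , λ xs → case dec xs of λ
  { (inj₁ (h , p⇓)) → inj₁ (P⇒Q h , p⇓)
  ; (inj₂ (h , p⇓)) → inj₂ (h ∘ Q⇒P , p⇓) }

zeroᵈ : ∀ {n} {f : Vec ℕ n → ℕ} → Computable f → DecidableBy (λ xs → f xs ≡ 0)
zeroᵈ {f = f} fᶜ =
  let p , p⇓ = ifzᶜ fᶜ (const 1) (const 0)
      go : ∀ xs m → f xs ≡ m → Decides p xs (f xs ≡ 0)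
      go = λ { xs zero    e≡ → inj₁ (e≡ , subst (λ m → p [ xs ]⇓ ifz m 1 0) e≡ (p⇓ xs))
             ; xs (suc m) e≡ → inj₂ ((λ z → case trans (sym e≡) z of λ ()) ,
                                     subst (λ m → p [ xs ]⇓ ifz m 1 0) e≡ (p⇓ xs)) }
  in p , λ xs → go xs (f xs) refl

infixr 2 _×ᵈ_
infixr 1 _⊎ᵈ_
infix 3 _≤ᵈ_ _<ᵈ_ _≡ᵈ_

¬ᵈ_ : ∀ {n} {P : Vec ℕ n → Set} → DecidableBy P → DecidableBy (λ xs → ¬ P xs)
¬ᵈ (p , dec) =
  let q , q⇓ = const 1 ∸ᶜ var (# 0) in
  comp q (p ∷ []) , λ xs → case dec xs of λ
  { (inj₁ (h , p⇓)) → inj₂ ((λ ¬h → ¬h h) , ⇓comp (p⇓ ∷ []) (q⇓ _))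
  ; (inj₂ (h , p⇓)) → inj₁ (h , ⇓comp (p⇓ ∷ []) (q⇓ _)) }

_×ᵈ_ : ∀ {n} {P Q : Vec ℕ n → Set} → DecidableBy P → DecidableBy Q →
       DecidableBy (λ xs → P xs × Q xs)
(p , dec) ×ᵈ (q , dec′) =
  let r , r⇓ = var (# 0) *ᶜ var (# 1) in
  comp r (p ∷ q ∷ []) , λ xs → case dec xs , dec′ xs of λ
  { (inj₁ (h , p⇓) , inj₁ (k , q⇓)) → inj₁ ((h , k) , ⇓comp (p⇓ ∷ q⇓ ∷ []) (r⇓ _))
  ; (inj₁ (h , p⇓) , inj₂ (k , q⇓)) → inj₂ (k ∘ proj₂ , ⇓comp (p⇓ ∷ q⇓ ∷ []) (r⇓ _))
  ; (inj₂ (h , p⇓) , inj₁ (k , q⇓)) → inj₂ (h ∘ proj₁ , ⇓comp (p⇓ ∷ q⇓ ∷ []) (r⇓ _))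
  ; (inj₂ (h , p⇓) , inj₂ (k , q⇓)) → inj₂ (h ∘ proj₁ , ⇓comp (p⇓ ∷ q⇓ ∷ []) (r⇓ _)) }

Decides⇒Dec : ∀ {n} {p : PRec n} {xs P} → Decides p xs P → Dec P
Decides⇒Dec (inj₁ (h , _)) = yes h
Decides⇒Dec (inj₂ (h , _)) = no h

-- De Morgan's law; the double negation goes away because both sides are decided by their programs.
_⊎ᵈ_ : ∀ {n} {P Q : Vec ℕ n → Set} → DecidableBy P → DecidableBy Q →
       DecidableBy (λ xs → P xs ⊎ Q xs)
P ⊎ᵈ Q =
  let P⊎Q? = λ xs → Decides⇒Dec (proj₂ P xs) ⊎-dec Decides⇒Dec (proj₂ Q xs) in
  mapᵈ (λ {xs} h → decidable-stable (P⊎Q? xs) λ ¬h → h (¬h ∘ inj₁ , ¬h ∘ inj₂))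
       (λ h (¬p , ¬q) → [ ¬p , ¬q ]′ h) (¬ᵈ (¬ᵈ P ×ᵈ ¬ᵈ Q))

_≤ᵈ_ : ∀ {n} {f g : Vec ℕ n → ℕ} → Computable f → Computable g →
       DecidableBy (λ xs → f xs ≤ g xs)
f ≤ᵈ g = mapᵈ m∸n≡0⇒m≤n m≤n⇒m∸n≡0 (zeroᵈ (f ∸ᶜ g))

_<ᵈ_ : ∀ {n} {f g : Vec ℕ n → ℕ} → Computable f → Computable g →
       DecidableBy (λ xs → f xs < g xs)
f <ᵈ g = sucᶜ f ≤ᵈ g

_≡ᵈ_ : ∀ {n} {f g : Vec ℕ n → ℕ} → Computable f → Computable g →
       DecidableBy (λ xs → f xs ≡ g xs)
f ≡ᵈ g = mapᵈ (λ (h , k) → ≤-antisym h k) (λ e≡ → ≤-reflexive e≡ , ≤-reflexive (sym e≡))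
              (f ≤ᵈ g ×ᵈ g ≤ᵈ f)

extᶜ : ∀ {n} {f g : Vec ℕ n → ℕ} → (∀ xs → f xs ≡ g xs) → Computable f → Computable g
extᶜ f≗g (p , p⇓) = p , λ xs → subst (p [ xs ]⇓_) (f≗g xs) (p⇓ xs)

-- Clocked evaluation

-- The first zero of a partial function c given by codes (0 for divergence, y + 1
-- for the value y), searched below b: 0 if there is none yet, 1 if c diverges
-- before a zero is met, and y + 2 if y is the zero.
search : (ℕ → ℕ) → ℕ → ℕ
search c zero    = 0
search c (suc b) =
  ifz (search c b) (ifz (c b) 1 (ifz (pred (c b)) (2 + b) 0)) (search c b)

-- With clock s, an evaluation gives 0 if it fails and y + 1 if it has value y.
-- The clock bounds only the searches.
mutual
  eval : ∀ {n} → PRec n → ℕ → Vec ℕ n → ℕ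
  eval zer        s xs            = 1
  eval succ       s (x ∷ [])      = 2 + x
  eval (proj i)   s xs            = suc (lookup xs i)
  eval (comp f gs) s xs           = ifz (converge gs s xs) 0 (eval f s (values gs s xs))
  eval (prim f g) s (zero ∷ xs)   = eval f s xs
  eval (prim f g) s (suc k ∷ xs)  =
    ifz (eval (prim f g) s (k ∷ xs)) 0 (eval g s (k ∷ pred (eval (prim f g) s (k ∷ xs)) ∷ xs))
  -- `pred` merges the outcomes 0 and 1 into failure and turns y + 2 into the code y + 1 of the
  -- value y.
  eval (mu f)     s xs            = pred (search (λ z → eval f s (z ∷ xs)) s)

  converge : ∀ {m n} → Vec (PRec n) m → ℕ → Vec ℕ n → ℕ
  converge []       s xs = 1
  converge (g ∷ gs) s xs = eval g s xs * converge gs s xs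

  values : ∀ {m n} → Vec (PRec n) m → ℕ → Vec ℕ n → Vec ℕ m
  values []       s xs = []
  values (g ∷ gs) s xs = pred (eval g s xs) ∷ values gs s xs

mutual
  -- The program stays at the meta level: only the clock and the arguments are inputs, and the
  -- construction follows `eval` scheme by scheme.
  evalᶜ : ∀ {n} (p : PRec n) → Computable (λ xs → eval p (head xs) (tail xs))
  evalᶜ zer         = const 1
  evalᶜ succ        = extᶜ (λ { (_ ∷ _ ∷ []) → refl }) (sucᶜ (sucᶜ (var (# 1))))
  evalᶜ (proj i)    = extᶜ (λ { (_ ∷ _) → refl }) (sucᶜ (var (suc i)))
  evalᶜ (comp f gs) =
    ifzᶜ (convergeᶜ gs) (const 0)
      (extᶜ (λ { (_ ∷ _) → refl }) (evalᶜ f ∘ᶜ var (# 0) ∷ᶜ valuesᶜ gs))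
  evalᶜ {suc n} (prim f g)  =
    extᶜ (λ { (_ ∷ _ ∷ _) → refl })
      (loop ∘ᶜ var (# 1) ∷ᶜ var (# 0) ∷ᶜ drop₂)
    where
    -- `recᶜ` recurses on the first argument, so the counter is moved in front of the clock.
    loop : Computable λ xs → eval (prim f g) (head (tail xs)) (head xs ∷ tail (tail xs))
    loop = recᶜ (evalᶜ f)
      (ifzᶜ (var (# 1)) (const 0)
         (evalᶜ g ∘ᶜ var (# 2) ∷ᶜ var (# 0) ∷ᶜ predᶜ (var (# 1)) ∷ᶜ drop₃))
      (λ { (_ ∷ _) → refl }) (λ { _ (_ ∷ _) → refl })
  evalᶜ {n} (mu f)      =
    extᶜ (λ { (_ ∷ _) → refl })
      -- The clock enters twice: as the bound of the search and as the clock of each test.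
      (predᶜ (loop ∘ᶜ var (# 0) ∷ᶜ var (# 0) ∷ᶜ drop₁))
    where
    value : Computable λ xs → eval f (lookup xs (# 2)) (lookup xs (# 0) ∷ tail (tail (tail xs)))
    value = evalᶜ f ∘ᶜ var (# 2) ∷ᶜ var (# 0) ∷ᶜ drop₃
    loop : Computable {2 + n} λ xs →
           search (λ z → eval f (head (tail xs)) (z ∷ tail (tail xs))) (head xs)
    loop = recᶜ (const 0)
      (ifzᶜ (var (# 1))
         (ifzᶜ value (const 1) (ifzᶜ (predᶜ value) (sucᶜ (sucᶜ (var (# 0)))) (const 0)))
         (var (# 1)))
      (λ _ → refl) (λ { _ (_ ∷ _) → refl })

  convergeᶜ : ∀ {m n} (gs : Vec (PRec n) m) →
             Computable (λ xs → converge gs (head xs) (tail xs))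
  convergeᶜ []       = const 1
  convergeᶜ (g ∷ gs) = evalᶜ g *ᶜ convergeᶜ gs

  valuesᶜ : ∀ {m n} (gs : Vec (PRec n) m) → Computable* (λ xs → values gs (head xs) (tail xs))
  valuesᶜ []       = []ᶜ
  valuesᶜ (g ∷ gs) = predᶜ (evalᶜ g) ∷ᶜ valuesᶜ gs

search-none : ∀ c b → search c b ≡ 0 → ∀ {z} → z < b → ∃[ k ] c z ≡ 2 + k
search-none c (suc b) none z<1+b with search c b in none-b | c b in cb
... | zero  | suc (suc k) with m≤n⇒m<n∨m≡n (s≤s⁻¹ z<1+b)
...   | inj₁ z<b  = search-none c b none-b z<b
...   | inj₂ refl = k , cb

search-found : ∀ c b {y} → search c b ≡ 2 + y →
               c y ≡ 1 × (∀ {z} → z < y → ∃[ k ] c z ≡ 2 + k)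
search-found c (suc b) found with search c b in result | c b in cb
search-found c (suc b) refl | zero    | suc zero = cb , search-none c b result
search-found c (suc b) refl | suc _   | _        = search-found c b result

search-first : ∀ c {y} → c y ≡ 1 → (∀ {z} → z < y → ∃[ k ] c z ≡ 2 + k) →
               ∀ {b} → y < b → search c b ≡ 2 + y
search-first c {y} cy below = after
  where
  before : ∀ {b} → b ≤ y → search c b ≡ 0
  before {zero}  _   = refl
  before {suc b} b<y with k , cb ← below b<y rewrite before (<⇒≤ b<y) | cb = refl

  after : ∀ {b} → y < b → search c b ≡ 2 + y
  after {suc b} y<1+b with m≤n⇒m<n∨m≡n (s≤s⁻¹ y<1+b)
  ... | inj₁ y<b  rewrite after y<b = refl
  ... | inj₂ refl rewrite before (≤-refl {y}) | cy = refl

ifz-suc : ∀ c {b y} → ifz c 0 b ≡ suc y → c ≡ suc (pred c) × b ≡ suc y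
ifz-suc (suc _) e = refl , e

mutual
  eval-sound : ∀ {n} (p : PRec n) s xs {y} → eval p s xs ≡ suc y → p [ xs ]⇓ y
  eval-sound zer         s []           refl = ⇓zer
  eval-sound succ        s (x ∷ [])     refl = ⇓succ
  eval-sound (proj i)    s xs           refl = ⇓proj
  eval-sound (comp f gs) s xs           e    =
    let c , e′ = ifz-suc _ e in
    ⇓comp (values-sound gs s xs c) (eval-sound f s _ e′)
  eval-sound (prim f g)  s (zero ∷ xs)  e    = ⇓prim0 (eval-sound f s xs e)
  eval-sound (prim f g)  s (suc k ∷ xs) e    =
    let r , e′ = ifz-suc _ e in
    ⇓prim+ (eval-sound (prim f g) s (k ∷ xs) r) (eval-sound g s _ e′)
  eval-sound (mu f)      s xs           e
    with search (λ z → eval f s (z ∷ xs)) s in r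
  -- The outcomes 0 and 1 are excluded, since `pred` sends both to 0.
  eval-sound (mu f)      s xs           refl | suc (suc y) =
    let found , below = search-found _ s r in
    ⇓mu (eval-sound f s _ found) λ z<y → let k , e = below z<y in k , eval-sound f s _ e

  values-sound : ∀ {m n} (gs : Vec (PRec n) m) s xs {c} → converge gs s xs ≡ suc c →
                 gs [ xs ]⇓* values gs s xs
  values-sound []       s xs _ = []
  values-sound (g ∷ gs) s xs c with eval g s xs in e | converge gs s xs in c′
  ... | suc _ | suc _ = eval-sound g s xs e ∷ values-sound gs s xs c′
  ... | suc m | zero  = case trans (sym (*-zeroʳ m)) c of λ ()

-- Completeness of clocked evaluation

Eventually : (ℕ → Set) → Set
Eventually P = ∃[ b ] ∀ {s} → b ≤ s → P s

infixr 2 _×ᵉ_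
_×ᵉ_ : ∀ {P Q : ℕ → Set} → Eventually P → Eventually Q → Eventually (λ s → P s × Q s)
(b , p) ×ᵉ (c , q) = b ⊔ c , λ b⊔c≤s → p (m⊔n≤o⇒m≤o b c b⊔c≤s) , q (m⊔n≤o⇒n≤o b c b⊔c≤s)

mapᵉ : ∀ {P Q : ℕ → Set} → (∀ {s} → P s → Q s) → Eventually P → Eventually Q
mapᵉ f (b , p) = b , f ∘ p

allᵉ : ∀ {P : ℕ → ℕ → Set} y → (∀ {z} → z < y → Eventually (P z)) →
       Eventually (λ s → ∀ {z} → z < y → P z s)
allᵉ zero    h = 0 , λ _ ()
allᵉ {P} (suc y) h = mapᵉ extend (allᵉ {P} y (h ∘ m<n⇒m<1+n) ×ᵉ h ≤-refl)
  where
  extend : ∀ {s} → (∀ {z} → z < y → P z s) × P y s → ∀ {z} → z < suc y → P z s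
  extend (below , at) z<1+y with m≤n⇒m<n∨m≡n (s≤s⁻¹ z<1+y)
  ... | inj₁ z<y  = below z<y
  ... | inj₂ refl = at

mutual
  -- Induction on the derivation: finitely many subderivations have a common clock bound. Claiming
  -- the value at all large clocks takes the place of monotonicity in the clock.
  eval-complete : ∀ {n} {p : PRec n} {xs y} → p [ xs ]⇓ y →
                  Eventually (λ s → eval p s xs ≡ suc y)
  eval-complete ⇓zer  = 0 , λ _ → refl
  eval-complete ⇓succ = 0 , λ _ → refl
  eval-complete ⇓proj = 0 , λ _ → refl
  eval-complete {xs = xs} (⇓comp {f = f} {gs} {ys = ys} {z} gs⇓ f⇓) =
    mapᵉ combine (values-complete gs⇓ ×ᵉ eval-complete f⇓)
    where
    combine : ∀ {s} → ((∃[ c ] converge gs s xs ≡ suc c) × values gs s xs ≡ ys)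
                      × eval f s ys ≡ suc z → eval (comp f gs) s xs ≡ suc z
    combine (((_ , c) , v) , e) rewrite c | v = e
  eval-complete (⇓prim0 f⇓) = eval-complete f⇓
  eval-complete (⇓prim+ {f = f} {g} {k} {xs} {y} {z} r⇓ g⇓) =
    mapᵉ combine (eval-complete r⇓ ×ᵉ eval-complete g⇓)
    where
    combine : ∀ {s} → eval (prim f g) s (k ∷ xs) ≡ suc y × eval g s (k ∷ y ∷ xs) ≡ suc z →
              eval (prim f g) s (suc k ∷ xs) ≡ suc z
    combine (r , e) rewrite r = e
  eval-complete {xs = xs} (⇓mu {f = f} {y = y} f⇓ below) =
    mapᵉ (λ ((found , below) , y<s) → cong pred (search-first _ found below y<s))
         ((eval-complete f⇓ ×ᵉ
           allᵉ {λ z s → ∃[ k ] eval f s (z ∷ xs) ≡ 2 + k} y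
             λ z<y → mapᵉ (proj₁ (below z<y) ,_) (eval-complete (proj₂ (below z<y))))
          ×ᵉ (suc y , id))

  values-complete : ∀ {m n} {gs : Vec (PRec n) m} {xs ys} → gs [ xs ]⇓* ys →
                    Eventually (λ s → (∃[ c ] converge gs s xs ≡ suc c) × values gs s xs ≡ ys)
  values-complete [] = 0 , λ _ → (0 , refl) , refl
  values-complete {xs = xs} (_∷_ {g = g} {gs} {y = y} {ys} g⇓ gs⇓) =
    mapᵉ combine (eval-complete g⇓ ×ᵉ values-complete gs⇓)
    where
    combine : ∀ {s} → eval g s xs ≡ suc y ×
                      (∃[ c ] converge gs s xs ≡ suc c) × values gs s xs ≡ ys →
              (∃[ c ] converge (g ∷ gs) s xs ≡ suc c) × values (g ∷ gs) s xs ≡ y ∷ ys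
    combine (e , (_ , c) , v) rewrite e | c | v = (_ , refl) , refl

-- At a common large clock both values are read off the same number `eval p s xs`.
⇓-deterministic : ∀ {n} {p : PRec n} {xs y z} → p [ xs ]⇓ y → p [ xs ]⇓ z → y ≡ z
⇓-deterministic y⇓ z⇓ =
  let b , both = eval-complete y⇓ ×ᵉ eval-complete z⇓
      e , e′   = both (≤-refl {b})
  in suc-injective (trans (sym e) e′)

-- Orders of type ω

module _ (em : ExcludedMiddle 0ℓ) (𝓛 : ComputableLinearOrder) where
  open ComputableLinearOrder 𝓛 renaming (_<_ to _⊏_) hiding (structure)
  open IsStrictTotalOrder isStrictTotalOrder using (compare)
    renaming (trans to ⊏-trans′; irrefl to ⊏-irrefl′)

  ⊏-trans : ∀ {x y z} → x ⊏ y → y ⊏ z → x ⊏ z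
  ⊏-trans x⊏y y⊏z =
    let Lx , Ly = <⊆L×L x⊏y; _ , Lz = <⊆L×L y⊏z in
    ⊏-trans′ {_ , Lx} {_ , Ly} {_ , Lz} x⊏y y⊏z

  ⊏-irrefl : ∀ {x} → ¬ x ⊏ x
  ⊏-irrefl x⊏x = let Lx , Lx′ = <⊆L×L x⊏x in ⊏-irrefl′ {_ , Lx} {_ , Lx′} refl x⊏x

  ⊏-connex : ∀ {x y} → L x → L y → x ⊏ y ⊎ x ≡ y ⊎ y ⊏ x
  ⊏-connex Lx Ly with compare (_ , Lx) (_ , Ly)
  ... | tri< x⊏y _ _ = inj₁ x⊏y
  ... | tri≈ _ x≡y _ = inj₂ (inj₁ x≡y)
  ... | tri> _ _ y⊏x = inj₂ (inj₂ y⊏x)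

  module _ (bounded : ∀ {y} → L y → ∃[ b ] ∀ {x} → x ⊏ y → x < b)
           (noMax   : ∀ {x} → L x → ∃[ y ] x ⊏ y) (nonempty : ∃ L) where

    Least : Pred ℕ 0ℓ → Pred ℕ 0ℓ
    Least P m = L m × P m × (∀ {y} → L y → P y → ¬ y ⊏ m)

    leastBelow : ∀ (P : Pred ℕ 0ℓ) b → (∀ {y} → y < b → ¬ (L y × P y)) ⊎
                 ∃[ m ] L m × P m × (∀ {y} → y < b → L y → P y → ¬ y ⊏ m)
    leastBelow P zero    = inj₁ λ ()
    leastBelow P (suc b) with em {L b × P b} | leastBelow P b
    ... | no ¬b | inj₁ none = inj₁ λ y<1+b → case m≤n⇒m<n∨m≡n (s≤s⁻¹ y<1+b) of λ
            { (inj₁ y<b) → none y<b ; (inj₂ refl) → ¬b }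
    ... | no ¬b | inj₂ (m , Lm , Pm , min) = inj₂ (m , Lm , Pm , λ y<1+b Ly Py →
            case m≤n⇒m<n∨m≡n (s≤s⁻¹ y<1+b) of λ
            { (inj₁ y<b) → min y<b Ly Py ; (inj₂ refl) → contradiction (Ly , Py) ¬b })
    ... | yes (Lb , Pb) | inj₁ none = inj₂ (b , Lb , Pb , λ y<1+b Ly Py →
            case m≤n⇒m<n∨m≡n (s≤s⁻¹ y<1+b) of λ
            { (inj₁ y<b) → contradiction (Ly , Py) (none y<b) ; (inj₂ refl) → ⊏-irrefl })
    ... | yes (Lb , Pb) | inj₂ (m , Lm , Pm , min) with ⊏-connex Lb Lm
    ...   | inj₁ b⊏m = inj₂ (b , Lb , Pb , λ y<1+b Ly Py y⊏b →
              case m≤n⇒m<n∨m≡n (s≤s⁻¹ y<1+b) of λ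
              { (inj₁ y<b) → min y<b Ly Py (⊏-trans y⊏b b⊏m) ; (inj₂ refl) → ⊏-irrefl y⊏b })
    ...   | inj₂ m⊑b = inj₂ (m , Lm , Pm , λ y<1+b Ly Py y⊏m →
              case m≤n⇒m<n∨m≡n (s≤s⁻¹ y<1+b) , m⊑b of λ
              { (inj₁ y<b , _) → min y<b Ly Py y⊏m
              ; (inj₂ refl , inj₁ refl) → ⊏-irrefl y⊏m
              ; (inj₂ refl , inj₂ m⊏b) → ⊏-irrefl (⊏-trans y⊏m m⊏b) })

    -- Everything below `x` in the order is numerically below `b`, so a minimum over a finite range
    -- is enough: what precedes it also precedes `x` and lies in the range.
    least : ∀ (P : Pred ℕ 0ℓ) {x} → L x → P x → ∃ (Least P)
    least P {x} Lx Px with bounded Lx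
    -- `suc x` brings `x` itself into the range, so that the range is not empty of candidates and
    -- the minimum found does not come after `x`.
    ... | b , below with leastBelow P (b ⊔ suc x)
    ...   | inj₁ none = contradiction (Lx , Px) (none (m≤n⊔m b (suc x)))
    ...   | inj₂ (m , Lm , Pm , min) = m , Lm , Pm , λ Ly Py y⊏m →
              min (≤-trans (below (y⊏x y⊏m)) (m≤m⊔n b (suc x))) Ly Py y⊏m
      where
      y⊏x : ∀ {y} → y ⊏ m → y ⊏ x
      y⊏x y⊏m with ⊏-connex Lm Lx
      ... | inj₁ m⊏x        = ⊏-trans y⊏m m⊏x
      ... | inj₂ (inj₁ refl) = y⊏m
      ... | inj₂ (inj₂ x⊏m) = contradiction x⊏m (min (m≤n⊔m b (suc x)) Lx Px)

    successor : ∀ {x} → L x → ∃ (Least (x ⊏_))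
    successor Lx = let y , x⊏y = noMax Lx in least _ (proj₂ (<⊆L×L x⊏y)) x⊏y

    ⊨Ψ : structure 𝓛 ⊨ Ψ
    ⊨Ψ (x , Lx) =
      let y , Ly , x⊏y , min = successor Lx in
      (y , Ly) , λ (z , Lz) → x⊏y , λ (x⊏z , z⊏y) → min Lz x⊏z z⊏y

    enum : ℕ → ∃ L
    enum zero    = let m , Lm , _ = least (λ _ → ⊤) (proj₂ nonempty) tt in m , Lm
    enum (suc n) = let m , Lm , _ = successor (proj₂ (enum n)) in m , Lm

    enum-step : ∀ n → proj₁ (enum n) ⊏ proj₁ (enum (suc n))
    enum-step n = proj₁ (proj₂ (proj₂ (successor (proj₂ (enum n)))))

    enum-mono : ∀ {m n} → m < n → proj₁ (enum m) ⊏ proj₁ (enum n)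
    enum-mono {m} {suc n} m<1+n with m≤n⇒m<n∨m≡n (s≤s⁻¹ m<1+n)
    ... | inj₁ m<n  = ⊏-trans (enum-mono m<n) (enum-step n)
    ... | inj₂ refl = enum-step n

    enum-injective : ∀ {m n} → proj₁ (enum m) ≡ proj₁ (enum n) → m ≡ n
    enum-injective {m} {n} e with <-cmp m n
    ... | tri< m<n _ _ = contradiction (subst (_ ⊏_) (sym e) (enum-mono m<n)) ⊏-irrefl
    ... | tri≈ _ m≡n _ = m≡n
    ... | tri> _ _ n<m = contradiction (subst (_⊏ _) (sym e) (enum-mono n<m)) ⊏-irrefl

    -- The enumeration cannot jump over `x`, because each new value is least above the previous one.
    enum-reaches : ∀ {x} → L x → ∀ n → (∃[ m ] proj₁ (enum m) ≡ x) ⊎ proj₁ (enum n) ⊏ x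
    enum-reaches Lx zero with least (λ _ → ⊤) (proj₂ nonempty) tt in e
    ... | m , Lm , _ , min with ⊏-connex Lx Lm
    ...   | inj₁ x⊏m         = contradiction x⊏m (min Lx tt)
    ...   | inj₂ (inj₁ refl) = inj₁ (0 , cong proj₁ e)
    ...   | inj₂ (inj₂ m⊏x)  = inj₂ m⊏x
    enum-reaches Lx (suc n) with enum-reaches Lx n
    ... | inj₁ found = inj₁ found
    ... | inj₂ gn⊏x with successor (proj₂ (enum n)) in e
    ...   | m , Lm , _ , min with ⊏-connex Lx Lm
    ...     | inj₁ x⊏m         = contradiction x⊏m (min Lx gn⊏x)
    ...     | inj₂ (inj₁ refl) = inj₁ (suc n , cong proj₁ e)
    ...     | inj₂ (inj₂ m⊏x)  = inj₂ m⊏x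

    enum-surjective : ∀ {x} → L x → ∃[ n ] proj₁ (enum n) ≡ x
    enum-surjective {x} Lx with bounded Lx
    ... | b , below with enum-reaches Lx b
    ...   | inj₁ found = found
    ...   | inj₂ gb⊏x  =
      -- If `x` were not reached by step `b`, the `b + 1` distinct values `enum 0`, ..., `enum b`
      -- would all precede `x` and so be numbers below `b`.
      let i , j , i<j , e = pigeonhole (≤-refl {suc b}) (λ i → fromℕ< (early i)) in
      contradiction (trans (sym (toℕ-fromℕ< (early i))) (trans (cong toℕ e) (toℕ-fromℕ< (early j))))
                    (<⇒≢ i<j ∘ enum-injective)
      where
      early : ∀ (i : Fin (suc b)) → proj₁ (enum (toℕ i)) < b
      early i with m≤n⇒m<n∨m≡n (s≤s⁻¹ (toℕ<n i))
      ... | inj₁ i<b = below (⊏-trans (enum-mono i<b) gb⊏x)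
      ... | inj₂ i≡b = below (subst (λ i → proj₁ (enum i) ⊏ x) (sym i≡b) gb⊏x)

    orderTypeω : OrderTypeω 𝓛
    orderTypeω = rank , record
      { isOrderMonomorphism = record
        { isOrderHomomorphism = record { cong = rank-cong ; mono = λ {x} {y} → rank-mono {x} {y} }
        ; injective = λ {x} {y} → rank-injective {x} {y}
        ; cancel    = λ {x} {y} r → subst₂ _⊏_ (enum-rank x) (enum-rank y) (enum-mono r)
        }
      ; surjective = λ n → enum n , λ {z} e → enum-injective (trans (enum-rank z) e)
      }
      where
      rank : ∃ L → ℕ
      rank (_ , Lx) = proj₁ (enum-surjective Lx)

      enum-rank : ∀ x → proj₁ (enum (rank x)) ≡ proj₁ x
      enum-rank (_ , Lx) = proj₂ (enum-surjective Lx)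

      -- The rank is read off a membership proof; injectivity of `enum` makes it depend on the
      -- number alone.
      rank-cong : ∀ {x y} → proj₁ x ≡ proj₁ y → rank x ≡ rank y
      rank-cong {x} {y} e = enum-injective (trans (enum-rank x) (trans e (sym (enum-rank y))))

      rank-injective : ∀ {x y} → rank x ≡ rank y → proj₁ x ≡ proj₁ y
      rank-injective {x} {y} e =
        trans (sym (enum-rank x)) (trans (cong (proj₁ ∘ enum) e) (enum-rank y))

      rank-mono : ∀ {x y} → proj₁ x ⊏ proj₁ y → rank x < rank y
      rank-mono {x} {y} x⊏y with <-cmp (rank x) (rank y)
      ... | tri< r _ _ = r
      ... | tri≈ _ r _ = contradiction
        (subst (_⊏ proj₁ y) (rank-injective {x} {y} r) x⊏y)
        ⊏-irrefl
      ... | tri> _ _ r = contradiction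
        (⊏-trans x⊏y (subst₂ _⊏_ (enum-rank y) (enum-rank x) (enum-mono r))) ⊏-irrefl

-- Finite sets and bounds

finite⇒bounded : ∀ {X} → Finite X → ∃[ b ] ∀ {x} → X x → x < b
finite⇒bounded (xs , X⊆xs , _) = let b , below = bound xs in b , below ∘ X⊆xs
  where
  bound : ∀ xs → ∃[ b ] ∀ {x} → x List.∈ xs → x < b
  bound []       = 0 , λ ()
  bound (y ∷ ys) = let b , below = bound ys in suc y ⊔ b , λ
    { (here refl)  → m≤m⊔n (suc y) b
    ; (there x∈ys) → ≤-trans (below x∈ys) (m≤n⊔m (suc y) b) }

bounded⇒finite : ExcludedMiddle 0ℓ → ∀ {X} b → (∀ {x} → X x → x < b) → Finite X
bounded⇒finite em {X} b below =
  filter (λ x → em {X x}) (upTo b) ,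
  (λ Xx → ∈-filter⁺ _ (∈-upTo⁺ (below Xx)) Xx) ,
  (λ x∈ → proj₂ (∈-filter⁻ _ {xs = upTo b} x∈))

-- The order of stages

-- The integer square root: it goes up at `suc x` exactly when the next square is at most `suc x`.
root : ℕ → ℕ
root zero    = 0
root (suc x) = ifz (suc (root x) * suc (root x) ∸ suc x) (suc (root x)) (root x)

rootᶜ : ∀ {n} {f : Vec ℕ n → ℕ} → Computable f → Computable (root ∘ f)
rootᶜ = map₁ᶜ root (recᶜ (const 0)
  (ifzᶜ (sucᶜ (var (# 1)) *ᶜ sucᶜ (var (# 1)) ∸ᶜ sucᶜ (var (# 0))) (sucᶜ (var (# 1))) (var (# 1)))
  (λ _ → refl) (λ _ _ → refl))

root-bounds : ∀ x → root x * root x ≤ x × x < suc (root x) * suc (root x)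
root-bounds zero    = z≤n , z<s
root-bounds (suc x) with root-bounds x | suc (root x) * suc (root x) ∸ suc x in e
... | _  , hi | zero  = m∸n≡0⇒m≤n e , ≤-<-trans hi (*-mono-< (n<1+n (suc (root x))) (n<1+n (suc (root x))))
... | lo , hi | suc _ = ≤-trans lo (n≤1+n x) , ≰⇒> λ h → case trans (sym e) (m≤n⇒m∸n≡0 h) of λ ()

-- Half of the uniqueness of the root; used in both directions it gives equality.
root-unique : ∀ {x k l} → k * k ≤ x → x < suc l * suc l → k ≤ l
root-unique lo hi = ≮⇒≥ λ l<k → <⇒≱ hi (≤-trans (*-mono-≤ l<k l<k) lo)

col : ℕ → ℕ
col x = x ∸ root x * root x

-- For `n ≤ k` the code lies in the interval from k² up to, but excluding, (k + 1)², so both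
-- coordinates can be recovered. Numbers with `root x < col x` are kept out of the order by
-- `Position`.
code : ℕ → ℕ → ℕ
code k n = k * k + n

code-decode : ∀ x → code (root x) (col x) ≡ x
code-decode x = m+[n∸m]≡n (proj₁ (root-bounds x))

root-code : ∀ {k n} → n ≤ k → root (code k n) ≡ k
root-code {k} {n} n≤k =
  ≤-antisym (root-unique {k = root (code k n)} {k} (proj₁ (root-bounds (code k n))) hi)
            (root-unique {k = k} (m≤m+n (k * k) n) (proj₂ (root-bounds (code k n))))
  where
  open ≤-Reasoning
  hi : code k n < suc k * suc k
  hi = begin-strict
    k * k + n          ≤⟨ +-monoʳ-≤ (k * k) n≤k ⟩
    k * k + k          ≡⟨ +-comm (k * k) k ⟩
    k + k * k          ≡⟨ *-suc k k ⟨
    k * suc k          <⟨ m<n+m (k * suc k) z<s ⟩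
    suc k * suc k      ∎

col-code : ∀ {k n} → n ≤ k → col (code k n) ≡ n
col-code {k} {n} n≤k rewrite root-code n≤k = m+n∸m≡n (k * k) n

code-mono : ∀ {k l m n} → k ≤ l → m ≤ n → code k m ≤ code l n
code-mono k≤l m≤n = +-mono-≤ (*-mono-≤ k≤l k≤l) m≤n

module _ (q : PRec 1) where

  -- The parity of the number of m < n on which q has not converged by time s.
  parity : ℕ → ℕ → ℕ
  parity s zero    = 0
  parity s (suc n) = ifz (eval q s (n ∷ [])) (1 ∸ parity s n) (parity s n)

  parityᶜ : ∀ {n} {f g : Vec ℕ n → ℕ} → Computable f → Computable g →
            Computable (λ xs → parity (f xs) (g xs))
  parityᶜ f g = map₂ᶜ (λ n s → parity s n)
    (recᶜ (const 0)
          (ifzᶜ (evalᶜ q ∘ᶜ var (# 2) ∷ᶜ var (# 0) ∷ᶜ []ᶜ) (const 1 ∸ᶜ var (# 1)) (var (# 1)))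
          (λ _ → refl) (λ { _ (_ ∷ []) → refl }))
    g f

  parity-01 : ∀ s n → parity s n ≡ 0 ⊎ parity s n ≡ 1
  parity-01 s zero = inj₁ refl
  parity-01 s (suc n) with eval q s (n ∷ []) | parity-01 s n
  ... | zero  | inj₁ e rewrite e = inj₂ refl
  ... | zero  | inj₂ e rewrite e = inj₁ refl
  ... | suc _ | e                = e

  Limit : ℕ → ℕ → Set
  Limit n v = Eventually (λ s → parity s n ≡ v)

  limit-unique : ∀ {n v w} → Limit n v → Limit n w → v ≡ w
  limit-unique v w = let b , both = v ×ᵉ w ; e , e′ = both (≤-refl {b}) in trans (sym e) e′

  limit-∈dom : ∀ {n v} → dom q n → Limit n v → Limit (suc n) v
  limit-∈dom {n} {v} (_ , q⇓) l = mapᵉ combine (eval-complete q⇓ ×ᵉ l)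
    where
    combine : ∀ {s y} → eval q s (n ∷ []) ≡ suc y × parity s n ≡ v → parity s (suc n) ≡ v
    combine (e , l) rewrite e = l

  limit-∉dom : ∀ {n v} → ¬ dom q n → Limit n v → Limit (suc n) (1 ∸ v)
  limit-∉dom {n} {v} n∉dom = mapᵉ flip
    where
    flip : ∀ {s} → parity s n ≡ v → parity s (suc n) ≡ 1 ∸ v
    flip {s} l with eval q s (n ∷ []) in e
    ... | zero  = cong (1 ∸_) l
    ... | suc y = contradiction (y , eval-sound q s _ e) n∉dom

  -- Classically each `m < n` either enters the domain at some stage or never does, and only the
  -- latter flips the limit.
  limit : ExcludedMiddle 0ℓ → ∀ n → ∃ (Limit n)
  limit em zero    = 0 , 0 , λ _ → refl
  limit em (suc n) with em {dom q n} | limit em n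
  ... | yes n∈dom | v , l = v , limit-∈dom n∈dom l
  ... | no  n∉dom | v , l = 1 ∸ v , limit-∉dom n∉dom l

  -- The alternative `k ≡ n` gives every column a last point. The convention `pred 0 = 0` is
  -- harmless: the only position in row 0 is (0 , 0), on the diagonal.
  Position : ℕ → ℕ → Set
  Position k n = n ≤ k × (k ≡ n ⊎ ¬ parity k n ≡ parity (pred k) n)

  record InL (x : ℕ) : Set where
    constructor inL
    field position : Position (root x) (col x)

  open InL

  data Precedes (x y : ℕ) : Set where
    left  : col x < col y → Precedes x y
    above : col x ≡ col y → root y < root x → Precedes x y

  infix 4 _⊏_
  _⊏_ : ℕ → ℕ → Set
  x ⊏ y = InL x × InL y × Precedes x y

  InL-code : ∀ {k n} → Position k n → InL (code k n)
  InL-code pos@(n≤k , _) = inL (subst₂ Position (sym (root-code n≤k)) (sym (col-code n≤k)) pos)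

  colᶜ : ∀ {n} {f : Vec ℕ n → ℕ} → Computable f → Computable (col ∘ f)
  colᶜ f = f ∸ᶜ rootᶜ f *ᶜ rootᶜ f

  -- Later arguments use only what these programs decide, never their code.
  abstract
    InLᵈ : ∀ {n} {f : Vec ℕ n → ℕ} → Computable f → DecidableBy (InL ∘ f)
    InLᵈ f = mapᵈ inL position ((colᶜ f ≤ᵈ rootᶜ f) ×ᵈ
      ((rootᶜ f ≡ᵈ colᶜ f) ⊎ᵈ
       ¬ᵈ (parityᶜ (rootᶜ f) (colᶜ f) ≡ᵈ parityᶜ (predᶜ (rootᶜ f)) (colᶜ f))))

    _⊏ᵈ_ : ∀ {n} {f g : Vec ℕ n → ℕ} → Computable f → Computable g →
           DecidableBy (λ xs → f xs ⊏ g xs)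
    f ⊏ᵈ g = InLᵈ f ×ᵈ InLᵈ g ×ᵈ
      mapᵈ [ left , (λ (e , r) → above e r) ]′
           (λ { (left c) → inj₁ c ; (above e r) → inj₂ (e , r) })
        ((colᶜ f <ᵈ colᶜ g) ⊎ᵈ ((colᶜ f ≡ᵈ colᶜ g) ×ᵈ (rootᶜ g <ᵈ rootᶜ f)))

  precedes-irrefl : ∀ {x} → ¬ Precedes x x
  precedes-irrefl (left c<c)    = <-irrefl refl c<c
  precedes-irrefl (above _ r<r) = <-irrefl refl r<r

  precedes-trans : ∀ {x y z} → Precedes x y → Precedes y z → Precedes x z
  precedes-trans (left c)    (left c′)     = left (<-trans c c′)
  precedes-trans (left c)    (above e _)   = left (<-≤-trans c (≤-reflexive e))
  precedes-trans (above e _) (left c)      = left (≤-<-trans (≤-reflexive e) c)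
  precedes-trans (above e r) (above e′ r′) = above (trans e e′) (<-trans r′ r)

  precedes-connex : ∀ x y → Precedes x y ⊎ x ≡ y ⊎ Precedes y x
  precedes-connex x y with <-cmp (col x) (col y) | <-cmp (root x) (root y)
  ... | tri< c _ _ | _          = inj₁ (left c)
  ... | tri> _ _ c | _          = inj₂ (inj₂ (left c))
  ... | tri≈ _ e _ | tri< r _ _ = inj₂ (inj₂ (above (sym e) r))
  ... | tri≈ _ e _ | tri> _ _ r = inj₁ (above e r)
  ... | tri≈ _ e _ | tri≈ _ r _ =
    inj₂ (inj₁ (trans (sym (code-decode x)) (trans (cong₂ code r e) (code-decode y))))

  stageOrder : ComputableLinearOrder
  stageOrder = record
    { L            = InL
    ; _<_          = _⊏_
    ; <⊆L×L        = λ (Lx , Ly , _) → Lx , Ly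
    ; L-computable = let p , dec = InLᵈ (var (# 0)) in p , λ x → dec (x ∷ [])
    ; <-computable = let p , dec = var (# 0) ⊏ᵈ var (# 1) in p , λ x y → dec (x ∷ y ∷ [])
    ; isStrictTotalOrder = record
      { isStrictPartialOrder = record
        { isEquivalence = record { refl = refl ; sym = sym ; trans = trans }
        ; irrefl        = λ { refl (_ , _ , x⊏x) → precedes-irrefl x⊏x }
        ; trans         = λ (Lx , _ , x⊏y) (_ , Lz , y⊏z) → Lx , Lz , precedes-trans x⊏y y⊏z
        ; <-resp-≈      = (λ { refl x⊏y → x⊏y }) , (λ { refl x⊏y → x⊏y })
        }
      ; compare = compare
      }
    }
    where
    compare : ∀ (x y : ∃ InL) → Tri (proj₁ x ⊏ proj₁ y) (proj₁ x ≡ proj₁ y) (proj₁ y ⊏ proj₁ x)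
    compare (x , Lx) (y , Ly) with precedes-connex x y
    ... | inj₁ x⊏y = tri< (Lx , Ly , x⊏y) (λ { refl → precedes-irrefl x⊏y })
                          (λ (_ , _ , y⊏x) → precedes-irrefl (precedes-trans x⊏y y⊏x))
    ... | inj₂ (inj₁ refl) = tri≈ (λ (_ , _ , x⊏x) → precedes-irrefl x⊏x) refl
                                  (λ (_ , _ , x⊏x) → precedes-irrefl x⊏x)
    ... | inj₂ (inj₂ y⊏x) = tri> (λ (_ , _ , x⊏y) → precedes-irrefl (precedes-trans x⊏y y⊏x))
                                 (λ { refl → precedes-irrefl y⊏x }) (Ly , Lx , y⊏x)

  diagonal : ∀ n → InL (code n n)
  diagonal n = InL-code {n} (≤-refl , inj₁ refl)

  stageOrder-bounded : ExcludedMiddle 0ℓ → ∀ {y} → InL y → ∃[ b ] ∀ {x} → x ⊏ y → x < b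
  stageOrder-bounded em {y} _ = suc (code (proj₁ settled ⊔ col y) (col y)) , λ {x} → below {x}
    where
    settled : Eventually λ s → ∀ {m} → m < suc (col y) → parity s m ≡ proj₁ (limit em m)
    settled = allᵉ {λ m s → parity s m ≡ proj₁ (limit em m)} (suc (col y)) λ {m} _ → proj₂ (limit em m)

    root≤ : ∀ {x} → InL x → col x ≤ col y → root x ≤ proj₁ settled ⊔ col y
    root≤ (inL (_ , inj₁ r≡c)) c≤ = ≤-trans (≤-trans (≤-reflexive r≡c) c≤) (m≤n⊔m _ (col y))
    root≤ {x} (inL (_ , inj₂ changed)) c≤ = ≤-trans (≮⇒≥ late) (m≤m⊔n _ (col y))
      where
      -- The strict inequality puts the stage before `root x`, too, at or past the settling stage,
      -- so no change can be seen there.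
      late : ¬ proj₁ settled < root x
      late b<r = changed (trans (proj₂ settled (<⇒≤ b<r) (s≤s c≤))
                                (sym (proj₂ settled (pred-mono-≤ b<r) (s≤s c≤))))

    below : ∀ {x} → x ⊏ y → x < suc (code (proj₁ settled ⊔ col y) (col y))
    below {x} (Lx , _ , x⊏y) =
      s≤s (subst (_≤ _) (code-decode x) (code-mono (root≤ {x} Lx c≤) c≤))
      where
      c≤ : col x ≤ col y
      c≤ = case x⊏y of λ { (left c) → <⇒≤ c ; (above e _) → ≤-reflexive e }

  stageOrder-noMax : ∀ {x} → InL x → ∃[ y ] x ⊏ y
  stageOrder-noMax {x} Lx =
    code (suc (col x)) (suc (col x)) , Lx , diagonal (suc (col x)) ,
    left (≤-reflexive (sym (col-code {suc (col x)} ≤-refl)))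

  -- A successor of the last element of column n is the first of column n + 1;
  -- after its row the parity for that column no longer changes.
  adjacent⇒limit : ∀ {n x} → code n n ⊏ x → (∀ {z} → ¬ (code n n ⊏ z × z ⊏ x)) →
                   Limit (suc n) (parity (root x) (suc n))
  adjacent⇒limit {n} {x} d⊏x@(_ , Lx@(inL (c≤r , _)) , d<x) none = root x , settled
    where
    col-diagonal : ∀ {m} → col (code m m) ≡ m
    col-diagonal {m} = col-code {m} ≤-refl

    -- Nothing follows the diagonal point inside column `n`: its row would be less than its column.
    n<c : n < col x
    n<c = case d<x of λ
      { (left c<)        → subst (_< col x) col-diagonal c<
      ; (above c≡ r<) → contradiction
          (≤-trans (≤-reflexive (trans (sym col-diagonal) c≡)) c≤r)
          (<⇒≱ (subst (root x <_) (root-code {n} ≤-refl) r<)) }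

    -- If `x` were in a later column, the diagonal point of column `n + 1` would lie in between.
    c≡1+n : col x ≡ suc n
    c≡1+n with m≤n⇒m<n∨m≡n n<c
    ... | inj₂ e    = sym e
    ... | inj₁ 1+n< = contradiction
      ( (diagonal n , diagonal (suc n) , left (subst₂ _<_ (sym col-diagonal) (sym (col-diagonal {suc n})) ≤-refl))
      , (diagonal (suc n) , Lx , left (subst (_< col x) (sym (col-diagonal {suc n})) 1+n<)))
      none

    -- A change from stage `s` to `s + 1` would put the point of row `s + 1` into column `n + 1`,
    -- ahead of `x` and so in between.
    unchanged : ∀ {s} → root x ≤ s → parity (suc s) (suc n) ≡ parity s (suc n)
    unchanged {s} r≤s with parity (suc s) (suc n) ≟ parity s (suc n)
    ... | yes same   = same
    ... | no changed = contradiction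
      ( (diagonal n , Lz , left (subst₂ _<_ (sym col-diagonal) (sym (col-code 1+n≤)) ≤-refl))
      , (Lz , Lx , above (trans (col-code 1+n≤) (sym c≡1+n))
                         (subst (root x <_) (sym (root-code 1+n≤)) (s≤s r≤s))))
      none
      where
      1+n≤ : suc n ≤ suc s
      1+n≤ = ≤-trans (subst (_≤ root x) c≡1+n c≤r) (m≤n⇒m≤1+n r≤s)

      Lz : InL (code (suc s) (suc n))
      Lz = InL-code (1+n≤ , inj₂ changed)

    settled : ∀ {s} → root x ≤ s → parity s (suc n) ≡ parity (root x) (suc n)
    settled {zero}  r≤s rewrite n≤0⇒n≡0 r≤s = refl
    settled {suc s} r≤s with m≤n⇒m<n∨m≡n r≤s
    ... | inj₁ r<1+s = trans (unchanged (s≤s⁻¹ r<1+s)) (settled (s≤s⁻¹ r<1+s))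
    ... | inj₂ r≡1+s = cong (λ s → parity s (suc n)) (sym r≡1+s)

-- Cohesive sets and the cohesive power

-- `C ⊆* P` with the list of exceptions replaced by a bound.
AlmostAll : Pred ℕ 0ℓ → Pred ℕ 0ℓ → Set
AlmostAll C P = ∃[ b ] ∀ {n} → C n → b ≤ n → P n

mapᵃ : ∀ {C P Q} → (∀ {n} → P n → Q n) → AlmostAll C P → AlmostAll C Q
mapᵃ f (b , p) = b , λ Cn b≤n → f (p Cn b≤n)

infixr 2 _×ᵃ_
_×ᵃ_ : ∀ {C P Q} → AlmostAll C P → AlmostAll C Q → AlmostAll C (λ n → P n × Q n)
(b , p) ×ᵃ (c , q) = b ⊔ c , λ Cn b⊔c≤n → p Cn (m⊔n≤o⇒m≤o b c b⊔c≤n) , q Cn (m⊔n≤o⇒n≤o b c b⊔c≤n)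

module _ (em : ExcludedMiddle 0ℓ) where

  ⊆*⇒almostAll : ∀ {C P} → C ⊆* P → AlmostAll C P
  ⊆*⇒almostAll {C} {P} fin = let b , below = finite⇒bounded fin in
    b , λ {n} Cn b≤n → decidable-stable (em {P n}) λ ¬Pn → <⇒≱ (below (Cn , ¬Pn)) b≤n

  almostAll⇒⊆* : ∀ {C P} → AlmostAll C P → C ⊆* P
  almostAll⇒⊆* (b , p) = bounded⇒finite em b λ (Cn , ¬Pn) → ≰⇒> (¬Pn ∘ p Cn)

  infinite⇒unbounded : ∀ {X} → Infinite X → ∀ b → ∃[ n ] X n × b ≤ n
  infinite⇒unbounded {X} inf b with em {∃[ n ] X n × b ≤ n}
  ... | yes found = found
  ... | no  none  = contradiction (bounded⇒finite em b λ Xn → ≰⇒> λ b≤n → none (_ , Xn , b≤n)) inf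

  -- Cohesiveness as it is used below: along `C`, a program finally always diverges or always
  -- converges.
  cohesive-dom : ∀ {C} → Cohesive C → (p : PRec 1) →
                 AlmostAll C (∁ (dom p)) ⊎ AlmostAll C (dom p)
  cohesive-dom (_ , coh) p with coh (dom p) (p , id , id)
  ... | inj₁ fin = let b , below = finite⇒bounded fin in
    inj₁ (b , λ Cn b≤n n∈ → <⇒≱ (below (n∈ , Cn)) b≤n)
  ... | inj₂ fin = let b , below = finite⇒bounded fin in
    inj₂ (b , λ Cn b≤n → decidable-stable em λ n∉ → <⇒≱ (below (n∉ , Cn)) b≤n)

-- Searching for a witness relative to a value of a partial function

leastWitness : ∀ {P : Pred ℕ 0ℓ} → (∀ n → Dec (P n)) → ∀ {n} → P n →
               ∃[ m ] P m × (∀ {k} → k < m → ¬ P k)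
leastWitness {P} P? {n} = go n (<-wellFounded n)
  where
  go : ∀ n → Acc _<_ n → P n → ∃[ m ] P m × (∀ {k} → k < m → ¬ P k)
  go n (acc smaller) Pn with anyUpTo? P? n
  ... | yes (k , k<n , Pk) = go k (smaller k<n) Pk
  ... | no  none           = n , Pn , λ k<n Pk → none (_ , k<n , Pk)

module _ (P : ℕ → ℕ → ℕ → Set)
         (Pᵈ : DecidableBy {3} λ xs → P (lookup xs (# 0)) (lookup xs (# 1)) (lookup xs (# 2)))
         (φ : PRec 1) where

  -- `mu` looks for a zero, so the negation is tested: the value is 0 where `P` holds. The probe
  -- diverges wherever `φ` does.
  probe : PRec 2
  probe = comp (proj₁ (¬ᵈ Pᵈ)) (proj (# 0) ∷ proj (# 1) ∷ comp φ (proj (# 1) ∷ []) ∷ [])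

  searchFor : PRec 1
  searchFor = mu probe

  P? : ∀ z n x → Dec (P z n x)
  P? z n x = Decides⇒Dec (proj₂ Pᵈ (z ∷ n ∷ x ∷ []))

  searchFor-sound : ∀ {n z} → searchFor [ n ∷ [] ]⇓ z → ∃[ x ] φ [ n ∷ [] ]⇓ x × P z n x
  searchFor-sound {n} {z} (⇓mu (⇓comp (⇓proj ∷ ⇓proj ∷ ⇓comp (⇓proj ∷ []) φ⇓ ∷ []) t⇓) _) =
    _ , φ⇓ , decidable-stable (P? z n _) (case proj₂ (¬ᵈ Pᵈ) (z ∷ n ∷ _ ∷ []) of λ
      { (inj₁ (_ , t⇓′)) → case ⇓-deterministic t⇓ t⇓′ of λ ()
      ; (inj₂ (¬¬p , _)) → ¬¬p })

  -- The least witness is taken because `mu` asks for a positive value, here 1, at all smaller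
  -- arguments.
  searchFor-complete : ∀ {n x z} → φ [ n ∷ [] ]⇓ x → P z n x → dom searchFor n
  searchFor-complete {n} {x} φ⇓ Pz =
    let y , Py , first = leastWitness (λ z → P? z n x) Pz in
    y , ⇓mu (test (case proj₂ (¬ᵈ Pᵈ) (y ∷ n ∷ x ∷ []) of λ
               { (inj₁ (¬p , _)) → contradiction Py ¬p ; (inj₂ (_ , t⇓)) → t⇓ }))
            (λ {z} z<y → 0 , test (case proj₂ (¬ᵈ Pᵈ) (z ∷ n ∷ x ∷ []) of λ
               { (inj₁ (_ , t⇓)) → t⇓ ; (inj₂ (¬¬p , _)) → contradiction (first z<y) ¬¬p }))
    where
    test : ∀ {z v} → proj₁ (¬ᵈ Pᵈ) [ z ∷ n ∷ x ∷ [] ]⇓ v → probe [ z ∷ n ∷ [] ]⇓ v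
    test t⇓ = ⇓comp (⇓proj ∷ ⇓proj ∷ ⇓comp (⇓proj ∷ []) φ⇓ ∷ []) t⇓

-- Failure of `Ψ` in the cohesive power

module _ (em : ExcludedMiddle 0ℓ) {C : Pred ℕ 0ℓ} (coh : Cohesive C)
         (q : PRec 1) (C⇒∉ : ∀ {n} → C n → ¬ dom q n) (∉⇒C : ∀ {n} → ¬ dom q n → C n) where

  -- Along C the limit flips at every step.
  limits-alternate : ∀ {v} → ¬ AlmostAll C (λ n → Limit q (suc n) v)
  limits-alternate {v} (b , l) =
    -- After `n₀` the limit is `v`, and it is still `v` on arriving at `n₁`; passing `n₁` turns it
    -- into `1 ∸ v`, where the hypothesis demands `v`.
    let n₀ , Cn₀ , b≤n₀ = infinite⇒unbounded em (proj₁ coh) b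
        n₁ , Cn₁ , n₀<n₁ = infinite⇒unbounded em (proj₁ coh) (suc n₀)
    in v≢1∸v v (limit-unique q (l Cn₁ (≤-trans b≤n₀ (<⇒≤ n₀<n₁)))
                            (limit-∉dom q (C⇒∉ Cn₁) (constant Cn₀ b≤n₀ n₀<n₁)))
    where
    v≢1∸v : ∀ v → ¬ v ≡ 1 ∸ v
    v≢1∸v (suc v) e = case trans e (0∸n≡0 v) of λ ()

    -- After an intermediate element of `C` the hypothesis gives `v` again, so `n₁` may be any later
    -- element of `C`.
    constant : ∀ {n₀ n} → C n₀ → b ≤ n₀ → n₀ < n → Limit q n v
    constant {n₀} {suc n} Cn₀ b≤n₀ n₀<1+n with m≤n⇒m<n∨m≡n (s≤s⁻¹ n₀<1+n) | em {dom q n}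
    ... | inj₂ refl  | _        = l Cn₀ b≤n₀
    ... | inj₁ n₀<n  | yes n∈   = limit-∈dom q n∈ (constant Cn₀ b≤n₀ n₀<n)
    ... | inj₁ n₀<n  | no  n∉   = l (∉⇒C n∉) (≤-trans b≤n₀ (<⇒≤ n₀<n))

  𝓛 : ComputableLinearOrder
  𝓛 = stageOrder q

  abstract
    diagonalᶜ : Computable {1} (λ xs → code (lookup xs (# 0)) (lookup xs (# 0)))
    diagonalᶜ = var (# 0) *ᶜ var (# 0) +ᶜ var (# 0)

  ψ : D C 𝓛
  ψ = record
    { φ       = proj₁ diagonalᶜ
    ; φ-range = λ {n} ⇓y → subst (InL q) (⇓-deterministic (proj₂ diagonalᶜ _) ⇓y) (diagonal q n)
    ; φ-dom   = almostAll⇒⊆* em (0 , λ _ _ → _ , proj₂ diagonalᶜ _)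
    }

  ¬⊨Ψ : CohesivePower C 𝓛 ⊨ ~ Ψ
  ¬⊨Ψ h with h ψ
  ... | f , successor = [ noneBetween , someBetween ]′ (cohesive-dom em coh between)
    where
    φ = D.φ f

    ψ<φ : AlmostAll C (λ n → ∃[ x ] φ [ n ∷ [] ]⇓ x × _⊏_ q (code n n) x)
    ψ<φ = mapᵃ (λ { (a , x , a⇓ , x⇓ , a⊏x) → x , x⇓ ,
                    subst (λ a → _⊏_ q a x) (⇓-deterministic a⇓ (proj₂ diagonalᶜ _)) a⊏x })
               -- In `Ψ` the conjunct `x ≺ y` stands under the innermost quantifier; it is read off
               -- at the instance `ψ`.
               (⊆*⇒almostAll em (proj₁ (successor ψ)))

    Between : ℕ → ℕ → ℕ → Set
    Between z n x = _⊏_ q (code n n) z × _⊏_ q z x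

    abstract
      Betweenᵈ : DecidableBy {3} λ xs → Between (lookup xs (# 0)) (lookup xs (# 1)) (lookup xs (# 2))
      Betweenᵈ = _⊏ᵈ_ q (var (# 1) *ᶜ var (# 1) +ᶜ var (# 1)) (var (# 0)) ×ᵈ
                 _⊏ᵈ_ q (var (# 0)) (var (# 2))

    between : PRec 1
    between = searchFor Between Betweenᵈ φ

    between-sound : ∀ {n z} → between [ n ∷ [] ]⇓ z → ∃[ x ] φ [ n ∷ [] ]⇓ x × Between z n x
    between-sound = searchFor-sound Between Betweenᵈ φ

    -- The search program would itself be an element of the power, strictly between `ψ` and `f`.
    someBetween : ¬ AlmostAll C (dom between)
    someBetween total = proj₂ (successor z)
      ( almostAll⇒⊆* em (mapᵃ (λ (_ , z⇓) → let _ , _ , ψ⊏z , _ = between-sound z⇓ in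
                                _ , _ , proj₂ diagonalᶜ _ , z⇓ , ψ⊏z) total)
      , almostAll⇒⊆* em (mapᵃ (λ (_ , z⇓) → let _ , x⇓ , _ , z⊏x = between-sound z⇓ in
                                _ , _ , z⇓ , x⇓ , z⊏x) total))
      where
      z : D C 𝓛
      z = record
        { φ       = between
        ; φ-range = λ z⇓ → let _ , _ , (_ , Lz , _) , _ = between-sound z⇓ in Lz
        ; φ-dom   = almostAll⇒⊆* em total
        }

    -- The first argument is a dummy: searching over it turns the test into a program that converges
    -- exactly where `φ` does and the parity is 0.
    Even : ℕ → ℕ → ℕ → Set
    Even _ n x = parity q (root x) (suc n) ≡ 0

    abstract
      Evenᵈ : DecidableBy {3} λ xs → Even (lookup xs (# 0)) (lookup xs (# 1)) (lookup xs (# 2))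
      Evenᵈ = zeroᵈ (parityᶜ q (rootᶜ (var (# 2))) (sucᶜ (var (# 1))))

    even : PRec 1
    even = searchFor Even Evenᵈ φ

    -- Now the value of `φ` is adjacent to the diagonal point for almost all `n` in `C`, so its row
    -- yields the limit. Cohesiveness applied to `even` makes these limits finally constant along
    -- `C`, against `limits-alternate`.
    noneBetween : ¬ AlmostAll C (∁ (dom between))
    noneBetween none = [ odd-limits , even-limits ]′ (cohesive-dom em coh even)
      where
      Settled : ℕ → Set
      Settled n = ∃[ x ] φ [ n ∷ [] ]⇓ x × Limit q (suc n) (parity q (root x) (suc n))

      limits : AlmostAll C Settled
      limits = mapᵃ (λ ((x , x⇓ , ψ⊏x) , n∉) → x , x⇓ , adjacent⇒limit q ψ⊏x λ b →
                       n∉ (searchFor-complete Between Betweenᵈ φ x⇓ b))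
                    (ψ<φ ×ᵃ none)

      even-limits : ¬ AlmostAll C (dom even)
      even-limits evens = limits-alternate (mapᵃ at (limits ×ᵃ evens))
        where
        at : ∀ {n} → Settled n × dom even n → Limit q (suc n) 0
        at {n} ((x , x⇓ , l) , _ , e⇓) with x′ , x′⇓ , e ← searchFor-sound Even Evenᵈ φ e⇓
          with refl ← ⇓-deterministic x⇓ x′⇓ = subst (Limit q (suc n)) e l

      odd-limits : ¬ AlmostAll C (∁ (dom even))
      odd-limits odds = limits-alternate (mapᵃ at (limits ×ᵃ odds))
        where
        at : ∀ {n} → Settled n × ¬ dom even n → Limit q (suc n) 1
        at {n} ((x , x⇓ , l) , n∉) with parity-01 q (root x) (suc n)
        -- As `φ` converges at `n`, divergence of `even` can only come from odd parity.
        ... | inj₁ e = contradiction (searchFor-complete Even Evenᵈ φ {z = 0} x⇓ e) n∉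
        ... | inj₂ e = subst (Limit q (suc n)) e l

cohesive-≐ : ∀ {C E} → C ≐ E → Cohesive E → Cohesive C
cohesive-≐ {C} {E} (C⊆E , E⊆C) (inf , coh) =
  (λ (xs , C⊆ , ⊆C) → inf (xs , C⊆ ∘ E⊆C , C⊆E ∘ ⊆C)) ,
  λ W ce → [ inj₁ ∘ transfer , inj₂ ∘ transfer ]′ (coh W ce)
  where
  transfer : ∀ {V : Pred ℕ 0ℓ} → Finite (V ∩ E) → Finite (V ∩ C)
  transfer (xs , ⊆xs , xs⊆) =
    xs , (λ (Vn , Cn) → ⊆xs (Vn , C⊆E Cn)) , (λ n∈ → let Vn , En = xs⊆ n∈ in Vn , E⊆C En)

mainTheorem5 : ExcludedMiddle 0ℓ →
    (C : Pred ℕ 0ℓ) → CoMaximal C →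
    Σ[ 𝓛 ∈ ComputableLinearOrder ]
    OrderTypeω 𝓛 × structure 𝓛 ⊨ Ψ × CohesivePower C 𝓛 ⊨ ~ Ψ
mainTheorem5 em C (M , ((q , M⊆dom , dom⊆M) , coh) , C≐∁M@(C⊆∁M , ∁M⊆C)) =
  stageOrder q ,
  orderTypeω em (stageOrder q) bounded noMax nonempty ,
  ⊨Ψ em (stageOrder q) bounded noMax nonempty ,
  ¬⊨Ψ em (cohesive-≐ C≐∁M coh) q (λ Cn → C⊆∁M Cn ∘ dom⊆M) (λ n∉ → ∁M⊆C (n∉ ∘ M⊆dom))
  where
  bounded : ∀ {y} → InL q y → ∃[ b ] ∀ {x} → _⊏_ q x y → x < b
  bounded = stageOrder-bounded q em
  noMax : ∀ {x} → InL q x → ∃[ y ] _⊏_ q x y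
  noMax = stageOrder-noMax q
  nonempty : ∃ (InL q)
  nonempty = _ , diagonal q 0
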